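{- Let $G$ be a finite simple graph and $u$ a vertex of $G$ satisfying the NC property in $G$. Let $G^*$ be the graph obtained from $G$ by locally chordalizing all the holes of $G$ containing $u$ by $u$. Then $G^*$ has no hole that is not a hole of $G$ (i.e., the operation creates no new hole).
   Context: A hole of a graph is an induced cycle of length at least $4$. A vertex $u$ satisfies the NC property in $G$ if no hole of $G$ containing $u$ and hole of $G$ not containing $u$ share two consecutive edges (two edges with a common end that are consecutive on both holes). For a hole $H$ of $G$ and a vertex $u$ on $H$, locally chordalizing $H$ by $u$ means adding an edge $uv$ for every vertex $v$ on $H$ not adjacent to $u$; locally chordalizing all the holes of $G$ containing $u$ by $u$ means adding, simultaneously, all such edges for every hole of $G$ that contains $u$. -}

module Defs where

open import Data.Nat using (ℕ; suc; _≤_)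
open import Data.Fin using (Fin; toℕ)
open import Data.Product using (Σ; ∃; _×_; _,_)
open import Data.Sum using (_⊎_)
open import Data.Empty using (⊥)
open import Relation.Nullary using (¬_)
open import Relation.Binary.PropositionalEquality using (_≡_; _≢_)
open import Function.Definitions using (Injective)

record Graph (n : ℕ) : Set₁ where
  field
    Adj   : Fin n → Fin n → Set
    sym   : ∀ {x y} → Adj x y → Adj y x
    irref : ∀ {x} → ¬ Adj x x
open Graph public

Step : (k : ℕ) → Fin k → Fin k → Set
Step k i j = (toℕ j ≡ suc (toℕ i)) ⊎ ((suc (toℕ i) ≡ k) × (toℕ j ≡ 0))

Consec : (k : ℕ) → Fin k → Fin k → Set
Consec k i j = Step k i j ⊎ Step k j i

record IsHole {n : ℕ} (E : Fin n → Fin n → Set) (k : ℕ) (c : Fin k → Fin n) : Set where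
  field
    len≥4     : 4 ≤ k
    distinct  : Injective _≡_ _≡_ c
    consec⇒E  : ∀ i j → Consec k i j → E (c i) (c j)
    E⇒consec  : ∀ i j → E (c i) (c j) → Consec k i j

record Hole {n : ℕ} (E : Fin n → Fin n → Set) : Set where
  field
    len    : ℕ
    vtx    : Fin len → Fin n
    isHole : IsHole E len vtx
open Hole public

OnHole : ∀ {n} {E : Fin n → Fin n → Set} → Fin n → Hole E → Set
OnHole v H = ∃ λ i → vtx H i ≡ v

HoleEdge : ∀ {n} {E : Fin n → Fin n → Set} → Hole E → Fin n → Fin n → Set
HoleEdge H x y = Σ (Fin (len H)) λ i → Σ (Fin (len H)) λ j →
  Consec (len H) i j × (vtx H i ≡ x) × (vtx H j ≡ y)

-- NC property: no hole containing u and hole not containing u share two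
-- consecutive edges ab, bc (a ≠ c; on a cycle two distinct edges at b are
-- automatically consecutive).
NC : ∀ {n} → Graph n → Fin n → Set
NC G u = (H₁ H₂ : Hole (Adj G)) → OnHole u H₁ → ¬ OnHole u H₂ →
  (a b c : Fin _) → a ≢ c →
  HoleEdge H₁ a b → HoleEdge H₁ b c → HoleEdge H₂ a b → HoleEdge H₂ b c → ⊥

-- New edge u v added by locally chordalizing some hole H of G containing u:
-- v lies on H, v ≠ u (and v is not adjacent to u; if it were, nothing changes).
NewEdge : ∀ {n} → Graph n → Fin n → Fin n → Set
NewEdge G u v = Σ (Hole (Adj G)) λ H → OnHole u H × OnHole v H × v ≢ u × ¬ Adj G u v

StarAdj : ∀ {n} → Graph n → Fin n → Fin n → Fin n → Set
StarAdj G u x y = Adj G x y ⊎ ((x ≡ u × NewEdge G u y) ⊎ (y ≡ u × NewEdge G u x))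

{-# OPTIONS --safe #-}
module Submission where

open import Defs
open import Data.Nat using (ℕ; zero; suc; _≤_; _<_; z≤n; s≤s)
open import Data.Nat.Properties using (suc-injective; <-cmp; ≤-trans; ≤-reflexive; <⇒≢; <⇒≱; n≤1+n; n≮0)
open import Data.Fin using (Fin; zero; suc; toℕ; inject₁; fromℕ)
open import Data.Fin.Properties using (_≟_; toℕ-inject₁; toℕ-fromℕ; toℕ<n; toℕ-injective; sequence)
open import Data.List using (List; []; _∷_; [_]; _++_; _ʳ++_; reverse; length; lookup; tabulate)
open import Data.List.Properties using (++-assoc; ++-ʳ++; ʳ++-defn; length-++-comm; length-++-≤ʳ; length-tabulate)
open import Data.List.Membership.Propositional using (_∈_)
open import Data.List.Membership.Propositional.Properties
  using (∈-++⁺ʳ; ∈-++⁻; ∈-∃++; ∈-lookup; ∈-tabulate⁺; ∈-tabulate⁻)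
open import Data.List.Relation.Unary.All as All using (All; []; _∷_)
import Data.List.Relation.Unary.All.Properties as All
open import Data.List.Relation.Unary.Any as Any using (Any; here; there)
import Data.List.Relation.Unary.Any.Properties as Any
open import Data.List.Relation.Binary.Permutation.Propositional using (_↭_; ↭-refl; ↭-sym)
open import Data.List.Relation.Binary.Permutation.Propositional.Properties using (++-comm; ∈-resp-↭)
open import Data.Product using (∃; _×_; _,_; proj₁; proj₂)
open import Data.Sum using (_⊎_; inj₁; inj₂; [_,_]′)
open import Data.Empty using (⊥; ⊥-elim)
open import Effect.Monad using (RawMonad)
open import Function using (_∘_; id)
open import Relation.Binary using (Decidable; tri<; tri≈; tri>)
open import Relation.Binary.PropositionalEquality using (_≡_; _≢_; refl; cong; subst; trans)
  renaming (sym to ≡-sym)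
open import Relation.Nullary using (¬_; yes; no)
open import Relation.Nullary.Decidable using (_⊎-dec_; ¬¬-excluded-middle)
open import Relation.Nullary.Negation using (¬¬-Monad)

-- In a hole of G* through u with a new edge uv, let x be the other neighbour of v and w the
-- other neighbour of u. Let H be a hole of G through u and v, and D the component of w in
-- G − N[v] − u. An induced path whose ends attach to a connected set that stays far from its
-- interior closes up to a hole (closeUp); this is used three times.
-- (1) Not both neighbours a, b of v on H attach to D: otherwise D closes up a v b to a hole
--     avoiding u, against NC.
-- (2) u attaches to D: otherwise w lies on a hole with u, both of whose arcs from w reach N(v)
--     before u, and v closes up the stretch between to a hole avoiding u, against NC.
-- (3) By (1) one of the arcs of H from v to u stays far from D until u. As x attaches to D and
--     to v, the path from x to u along that arc, shortcut, is closed up by D to a hole of G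
--     through u and x. So x is adjacent to u in G*, a contradiction.
-- The goal of this argument is ⊥, so adjacency in G may be assumed decidable.
module InducedPaths {n : ℕ} (G : Graph n) where

  -- Induced paths as vertex lists.

  Near Far : Fin n → Fin n → Set
  Near x y = x ≡ y ⊎ Adj G x y
  Far x y = ¬ Near x y

  near-sym : ∀ {x y} → Near x y → Near y x
  near-sym (inj₁ x≡y) = inj₁ (≡-sym x≡y)
  near-sym (inj₂ x~y) = inj₂ (sym G x~y)

  far-sym : ∀ {x y} → Far x y → Far y x
  far-sym x≁y = x≁y ∘ near-sym

  data Touch (x : Fin n) : List (Fin n) → Set where
    []  : Touch x []
    _∷_ : ∀ {y ys} → Adj G x y → All (Far x) ys → Touch x (y ∷ ys)

  -- Consecutive vertices differ by irreflexivity, and `Far` excludes equality as well as adjacency,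
  -- so distinctness is built in.
  data Induced : List (Fin n) → Set where
    []  : Induced []
    _∷_ : ∀ {x xs} → Touch x xs → Induced xs → Induced (x ∷ xs)

  AllFar : List (Fin n) → List (Fin n) → Set
  AllFar xs ys = All (λ x → All (Far x) ys) xs

  induced-head : ∀ {x xs} → Induced (x ∷ xs) → Touch x xs
  induced-head (t ∷ _) = t

  touch-take : ∀ xs {x ys} → Touch x (xs ++ ys) → Touch x xs
  touch-take []       t       = []
  touch-take (y ∷ xs) (a ∷ f) = a ∷ All.++⁻ˡ xs f

  induced-take : ∀ xs {ys} → Induced (xs ++ ys) → Induced xs
  induced-take []       p       = []
  induced-take (x ∷ xs) (t ∷ p) = touch-take xs t ∷ induced-take xs p

  induced-drop : ∀ xs {ys} → Induced (xs ++ ys) → Induced ys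
  induced-drop []       p       = p
  induced-drop (x ∷ xs) (t ∷ p) = induced-drop xs p

  induced-upto : ∀ xs {y ys} → Induced (xs ++ y ∷ ys) → Induced (xs ++ [ y ])
  induced-upto xs {y} {ys} p = induced-take (xs ++ [ y ]) (subst Induced (≡-sym (++-assoc xs [ y ] ys)) p)

  -- The vertex `y` lies between the two sides, so they are at least two steps apart.
  induced-cross : ∀ xs {y ys} → Induced (xs ++ y ∷ ys) → AllFar xs ys
  induced-cross []           p             = []
  induced-cross (x ∷ [])     ((_ ∷ f) ∷ p) = f ∷ []
  induced-cross (x ∷ z ∷ xs) ((_ ∷ f) ∷ p) = All.tail (All.++⁻ʳ xs f) ∷ induced-cross (z ∷ xs) p

  -- Pairs between `xs` and `ys` are the only ones that neither piece controls.
  induced-join : ∀ xs {y ys} → Induced (xs ++ [ y ]) → Induced (y ∷ ys) → AllFar xs ys →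
    Induced (xs ++ y ∷ ys)
  induced-join []           p             q c        = q
  induced-join (x ∷ [])     ((a ∷ _) ∷ p) q (c ∷ []) = (a ∷ c) ∷ q
  induced-join (x ∷ z ∷ xs) ((a ∷ f) ∷ p) q (c ∷ cs) =
    (a ∷ All.++⁺ (All.++⁻ˡ xs f) (All.head (All.++⁻ʳ xs f) ∷ c)) ∷ induced-join (z ∷ xs) p q cs

  -- Glues two paths that leave `x`. Each step moves one vertex from the first path to the front of
  -- the second.
  induced-ʳ++ : ∀ {x} xs {ys} → Induced (x ∷ xs) → Induced (x ∷ ys) → AllFar xs ys →
    Induced (xs ʳ++ x ∷ ys)
  induced-ʳ++ []       p             q c        = q
  induced-ʳ++ (z ∷ zs) ((a ∷ f) ∷ p) q (c ∷ cs) =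
    induced-ʳ++ zs p ((sym G a ∷ c) ∷ q)
      (All.zipWith (λ (x≁ , ys≁) → far-sym x≁ ∷ ys≁) (f , cs))

  induced-reverse : ∀ {xs} → Induced xs → Induced (reverse xs)
  induced-reverse {[]}     p = []
  induced-reverse {x ∷ xs} p = induced-ʳ++ xs p ([] ∷ []) (All.universal (λ _ → []) xs)

  induced-≢ : ∀ {x xs y} → Induced (x ∷ xs) → y ∈ xs → x ≢ y
  induced-≢ ((a ∷ _) ∷ _) (here refl) refl = irref G a
  induced-≢ ((_ ∷ f) ∷ _) (there y∈)  x≡y  = All.lookup f y∈ (inj₁ x≡y)

  induced-end : ∀ xs {y} → Induced (xs ++ [ y ]) → All (_≢ y) xs
  induced-end []       p         = []
  induced-end (x ∷ xs) p@(_ ∷ q) = induced-≢ p (∈-++⁺ʳ xs (here refl)) ∷ induced-end xs q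

  induced-next : ∀ {x y} xs → Induced (x ∷ xs ++ [ y ]) → ∃ λ z → z ∈ xs ++ [ y ] × Adj G x z
  induced-next []       ((a ∷ _) ∷ _) = _ , here refl , a
  induced-next (z ∷ xs) ((a ∷ _) ∷ _) = _ , here refl , a

  induced-lookup-step : ∀ {xs} → Induced xs → ∀ i j → toℕ j ≡ suc (toℕ i) → Adj G (lookup xs i) (lookup xs j)
  induced-lookup-step ((a ∷ _) ∷ _) zero    (suc zero) _ = a
  induced-lookup-step (_ ∷ p)       (suc i) (suc j)    e = induced-lookup-step p i j (suc-injective e)

  induced-lookup-near : ∀ {xs} → Induced xs → ∀ i j → toℕ i < toℕ j → Near (lookup xs i) (lookup xs j) →
    toℕ j ≡ suc (toℕ i)
  induced-lookup-near ((a ∷ _) ∷ _) zero    (suc zero)    _       e = refl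
  induced-lookup-near ((_ ∷ f) ∷ _) zero    (suc (suc j)) _       e = ⊥-elim (All.lookup f (∈-lookup j) e)
  induced-lookup-near (_ ∷ p)       (suc i) (suc j)       (s≤s l) e = cong suc (induced-lookup-near p i j l e)

  induced-tabulate : ∀ {m} (f : Fin m → Fin n) →
    (∀ i j → toℕ j ≡ suc (toℕ i) → Adj G (f i) (f j)) →
    (∀ i j → suc (toℕ i) < toℕ j → Far (f i) (f j)) →
    Induced (tabulate f)
  induced-tabulate {zero}        f adj far = []
  induced-tabulate {suc zero}    f adj far = [] ∷ []
  induced-tabulate {suc (suc m)} f adj far =
    (adj zero (suc zero) refl ∷ All.tabulate⁺ (λ i → far zero (suc (suc i)) (s≤s (s≤s z≤n))))
    ∷ induced-tabulate (f ∘ suc) (λ i j e → adj (suc i) (suc j) (cong suc e))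
                                 (λ i j l → far (suc i) (suc j) (s≤s l))

  -- Holes as cyclic lists, and back.

  -- h ∷ T, read cyclically, is an induced cycle of length at least 4.
  record Cyclic (h : Fin n) (T : List (Fin n)) : Set where
    field
      {mids} : List (Fin n)
      {end}  : Fin n
      split  : T ≡ mids ++ [ end ]
      front  : Induced (h ∷ mids)
      back   : Induced T
      close  : Adj G end h
      big    : 3 ≤ length T

  -- The old `back` becomes the new `front`. The new `back` ends in `h`, whose only neighbours on
  -- the cycle are `y` and the old end.
  rotate : ∀ {h y T} → Cyclic h (y ∷ T) → Cyclic y (T ++ [ h ])
  rotate {h} {T = T} record { mids = [] ; split = refl ; big = s≤s () }
  rotate {h} {T = T} record { mids = y ∷ ms ; end = z ; split = refl ; front = (a ∷ f) ∷ _
                            ; back = t ∷ p ; close = c ; big = big } = record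
    { split = refl
    ; front = t ∷ p
    ; back  = subst Induced (≡-sym (++-assoc ms [ z ] [ h ]))
                (induced-join ms p ((c ∷ []) ∷ [] ∷ []) (All.map (λ x≁ → far-sym x≁ ∷ []) f))
    ; close = a
    ; big   = ≤-trans big (≤-reflexive (length-++-comm [ h ] T))
    }

  rotateTo : ∀ {h u} A {B} → Cyclic h (A ++ u ∷ B) → Cyclic u (B ++ h ∷ A)
  rotateTo []               c = rotate c
  rotateTo {h} {u} (a ∷ A) {B} c =
    subst (Cyclic u) (++-assoc B [ h ] (a ∷ A))
      (rotateTo A (subst (Cyclic a) (++-assoc A (u ∷ B) [ h ]) (rotate c)))

  rotate-∈ : ∀ {h T u} → Cyclic h T → u ∈ h ∷ T → ∃ λ T′ → Cyclic u T′ × h ∷ T ↭ u ∷ T′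
  rotate-∈ c (here refl) = _ , c , ↭-refl
  rotate-∈ {h} {u = u} c (there u∈) with ∈-∃++ u∈
  ... | A , B , refl = _ , rotateTo A c , ++-comm (h ∷ A) (u ∷ B)

  near-head-ends : ∀ {h z} ms → Touch h ms → ∀ i → Near h (lookup (ms ++ [ z ]) i) →
    toℕ i ≡ 0 ⊎ suc (toℕ i) ≡ length (ms ++ [ z ])
  near-head-ends []       t       zero    e = inj₁ refl
  near-head-ends (y ∷ ms) t       zero    e = inj₁ refl
  near-head-ends (y ∷ ms) (_ ∷ f) (suc i) e = inj₂ (cong suc (isLast ms f i e))
    where
    isLast : ∀ {h z} ms → All (Far h) ms → ∀ i → Near h (lookup (ms ++ [ z ]) i) →
      suc (toℕ i) ≡ length (ms ++ [ z ])
    isLast []       _       zero    e = refl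
    isLast (m ∷ ms) (f ∷ _) zero    e = ⊥-elim (f e)
    isLast (m ∷ ms) (_ ∷ f) (suc i) e = cong suc (isLast ms f i e)

  lookup-last : ∀ ms {z : Fin n} (i : Fin (length (ms ++ [ z ]))) → suc (toℕ i) ≡ length (ms ++ [ z ]) →
    lookup (ms ++ [ z ]) i ≡ z
  lookup-last []           zero    e = refl
  lookup-last (m ∷ [])     zero    ()
  lookup-last (m ∷ _ ∷ ms) zero    ()
  lookup-last (m ∷ ms)     (suc i) e = lookup-last ms i (suc-injective e)

  cyclic⇒isHole : ∀ {h T} → Cyclic h T → IsHole (Adj G) (length (h ∷ T)) (lookup (h ∷ T))
  cyclic⇒isHole {h} {T} record { mids = ms ; end = z ; split = refl ; front = t ∷ p
                               ; back = q ; close = c ; big = big } = record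
    { len≥4    = s≤s big
    ; distinct = λ {i} {j} → distinct′ i j
    ; consec⇒E = λ { i j (inj₁ s) → step i j s ; i j (inj₂ s) → sym G (step j i s) }
    ; E⇒consec = consec
    }
    where
    L = h ∷ T
    k = length L

    headStep : ∀ {ms} → Touch h ms → 3 ≤ length (ms ++ [ z ]) → ∀ j → toℕ j ≡ 0 →
      Adj G h (lookup (ms ++ [ z ]) j)
    headStep {[]}    _       (s≤s ()) j    e
    headStep {_ ∷ _} (a ∷ _) _        zero e = a

    step : ∀ i j → Step k i j → Adj G (lookup L i) (lookup L j)
    step zero    (suc j) (inj₁ e) = headStep t big j (suc-injective e)
    step (suc i) (suc j) (inj₁ e) = induced-lookup-step q i j (suc-injective e)
    step (suc i) zero    (inj₂ (e , _)) =
      subst (λ x → Adj G x h) (≡-sym (lookup-last ms i (suc-injective e))) c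
    step zero    zero    (inj₂ (e , _)) = ⊥-elim (<⇒≢ (≤-trans (s≤s z≤n) big) (suc-injective e))

    -- `Near` instead of adjacency serves twice: it excludes chords, and it makes equal vertices
    -- consecutive, hence adjacent, against irreflexivity.
    near : ∀ i j → toℕ i < toℕ j → Near (lookup L i) (lookup L j) → Consec k i j
    near zero (suc j) l e with near-head-ends ms t j e
    ... | inj₁ j≡0 = inj₁ (inj₁ (cong suc j≡0))
    ... | inj₂ j≡k = inj₂ (inj₂ (cong suc j≡k , refl))
    near (suc i) (suc j) (s≤s l) e = inj₁ (inj₁ (cong suc (induced-lookup-near q i j l e)))

    swap : ∀ {i j} → Consec k i j → Consec k j i
    swap = [ inj₂ , inj₁ ]′

    distinct′ : ∀ i j → lookup L i ≡ lookup L j → i ≡ j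
    distinct′ i j e with <-cmp (toℕ i) (toℕ j)
    ... | tri≈ _ i≡j _ = toℕ-injective i≡j
    ... | tri< l _ _ = ⊥-elim (irref G (subst (Adj G _) (≡-sym e)
            ([ step i j , sym G ∘ step j i ]′ (near i j l (inj₁ e)))))
    ... | tri> _ _ l = ⊥-elim (irref G (subst (Adj G _) e
            ([ step j i , sym G ∘ step i j ]′ (near j i l (inj₁ (≡-sym e))))))

    consec : ∀ i j → Adj G (lookup L i) (lookup L j) → Consec k i j
    consec i j a with <-cmp (toℕ i) (toℕ j)
    ... | tri< l _ _ = near i j l (inj₂ a)
    ... | tri> _ _ l = swap (near j i l (inj₂ (sym G a)))
    ... | tri≈ _ i≡j _ = ⊥-elim (irref G (subst (λ i → Adj G (lookup L i) _) (toℕ-injective i≡j) a))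

  cyclic⇒hole : ∀ {h T} → Cyclic h T → Hole (Adj G)
  cyclic⇒hole {h} {T} c = record { len = length (h ∷ T) ; vtx = lookup (h ∷ T) ; isHole = cyclic⇒isHole c }

  tabulate-snoc : ∀ {m} (f : Fin (suc m) → Fin n) → tabulate f ≡ tabulate (f ∘ inject₁) ++ [ f (fromℕ m) ]
  tabulate-snoc {zero}  f = refl
  tabulate-snoc {suc m} f = cong (f zero ∷_) (tabulate-snoc (f ∘ suc))

  isHole⇒cyclic : ∀ {k} (c : Fin (suc k) → Fin n) → IsHole (Adj G) (suc k) c →
    Cyclic (c zero) (tabulate (c ∘ suc))
  isHole⇒cyclic {zero}  c hole with s≤s () ← IsHole.len≥4 hole
  isHole⇒cyclic {suc k} c hole = record
    { split = tabulate-snoc (c ∘ suc)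
    ; front = induced-tabulate (c ∘ inject₁)
        (λ i j e → consec⇒E _ _ (inj₁ (inj₁
          (trans (toℕ-inject₁ j) (trans e (cong suc (≡-sym (toℕ-inject₁ i))))))))
        (λ i j l e → apart (inject₁ i) (inject₁ j)
          (subst (λ a → suc (suc a) ≤ _) (≡-sym (toℕ-inject₁ i))
            (subst (λ b → suc (suc (toℕ i)) ≤ b) (≡-sym (toℕ-inject₁ j)) l))
          -- Here `j` stops before the last index, so the pair is not the wrap-around one; in `back`
          -- the first index is nonzero instead.
          (λ (_ , w) → <⇒≢ (s≤s (toℕ<n j)) (trans (cong suc (≡-sym (toℕ-inject₁ j))) w)) e)
    ; back  = induced-tabulate (c ∘ suc)
        (λ i j e → consec⇒E _ _ (inj₁ (inj₁ (cong suc e))))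
        (λ i j l e → apart (suc i) (suc j) (s≤s l) (λ ()) e)
    ; close = consec⇒E _ _ (inj₁ (inj₂ (cong (λ m → suc (suc m)) (toℕ-fromℕ k) , refl)))
    ; big   = subst (3 ≤_) (≡-sym (length-tabulate (c ∘ suc))) (pred-≤ len≥4)
    }
    where
    open IsHole hole
    pred-≤ : ∀ {a b} → suc a ≤ suc b → a ≤ b
    pred-≤ (s≤s l) = l
    apart : ∀ i j → suc (toℕ i) < toℕ j → ¬ (toℕ i ≡ 0 × suc (toℕ j) ≡ suc (suc k)) → Far (c i) (c j)
    apart i j l w (inj₁ e) = <⇒≢ (≤-trans (s≤s (n≤1+n _)) l) (cong toℕ (distinct e))
    apart i j l w (inj₂ a) with E⇒consec i j a
    ... | inj₁ (inj₁ e) = <⇒≢ l (≡-sym e)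
    ... | inj₁ (inj₂ (_ , e)) = n≮0 (subst (_ <_) e l)
    ... | inj₂ (inj₁ e) = <⇒≱ l (≤-trans (n≤1+n _) (≤-trans (≤-reflexive (≡-sym e)) (n≤1+n _)))
    ... | inj₂ (inj₂ (e , e′)) = w (e′ , e)

  -- The rotation to start at `a` is a permutation, which carries membership in both directions.
  hole⇒cyclic : ∀ {a} (H : Hole (Adj G)) → OnHole a H →
    ∃ λ T → Cyclic a T × (∀ {x} → OnHole x H → x ∈ a ∷ T) × All (λ x → OnHole x H) T
  hole⇒cyclic record { len = suc k ; vtx = c ; isHole = hole } (i , refl)
    with rotate-∈ (isHole⇒cyclic c hole) (∈-tabulate⁺ {f = c} i)
  ... | T , cyc , perm = T , cyc , (λ { (j , refl) → ∈-resp-↭ perm (∈-tabulate⁺ {f = c} j) }) , All.tabulate on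
    where
    on : ∀ {x} → x ∈ T → ∃ λ j → c j ≡ x
    on x∈ with ∈-tabulate⁻ {f = c} (∈-resp-↭ (↭-sym perm) (there x∈))
    ... | j , e = j , ≡-sym e

  -- The two arcs of a hole, and edges shared by holes.

  reverse-arc : ∀ (a : Fin n) xs b → reverse (a ∷ xs ++ [ b ]) ≡ b ∷ reverse xs ++ [ a ]
  reverse-arc a xs b = trans (++-ʳ++ xs) (cong (b ∷_) (ʳ++-defn xs))

  record Arcs (H : Hole (Adj G)) (a b : Fin n) : Set where
    field
      {left right} : List (Fin n)
      leftPath  : Induced (a ∷ left ++ [ b ])
      rightPath : Induced (a ∷ right ++ [ b ])
      cross     : AllFar left right
      leftOn    : All (λ x → OnHole x H) left
      rightOn   : All (λ x → OnHole x H) right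

  far-after : ∀ {a b} A {B} → Far a b → Touch a (A ++ b ∷ B) → All (Far a) (b ∷ B)
  far-after []      a≁b (a~b ∷ _) = ⊥-elim (a≁b (inj₂ a~b))
  far-after (_ ∷ A) a≁b (_ ∷ f)   = All.++⁻ʳ A f

  ʳ++-assoc : ∀ xs {ys zs : List (Fin n)} → (xs ʳ++ ys) ++ zs ≡ xs ʳ++ (ys ++ zs)
  ʳ++-assoc []       = refl
  ʳ++-assoc (x ∷ xs) = ʳ++-assoc xs

  ʳ++⁺ : ∀ {P : Fin n → Set} {xs ys} → All P xs → All P ys → All P (xs ʳ++ ys)
  ʳ++⁺ []       qs = qs
  ʳ++⁺ (p ∷ ps) qs = ʳ++⁺ ps (p ∷ qs)

  ʳ++⁻ : ∀ {P : Fin n → Set} xs {ys} → All P (xs ʳ++ ys) → All P xs × All P ys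
  ʳ++⁻ []       qs = [] , qs
  ʳ++⁻ (x ∷ xs) qs with ʳ++⁻ xs qs
  ... | ps , p ∷ rs = p ∷ ps , rs

  reverse⁺ : ∀ {P : Fin n → Set} {xs} → All P xs → All P (reverse xs)
  reverse⁺ ps = ʳ++⁺ ps []

  -- The cyclic list from `a` is cut at `b`. The part after `b` leads back to `a`, so it is reversed
  -- to run from `a` as well.
  holeArcs : ∀ {a b} (H : Hole (Adj G)) → OnHole a H → OnHole b H → Far a b → Arcs H a b
  holeArcs {a} {b} H a∈H b∈H a≁b with hole⇒cyclic H a∈H
  ... | T , cyc , on⇒∈ , ∈⇒on with on⇒∈ b∈H
  ... | here b≡a = ⊥-elim (a≁b (inj₁ (≡-sym b≡a)))
  ... | there b∈T with cyc
  ... | record { mids = ms ; end = z ; split = refl ; front = front ; back = back ; close = close }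
    with ∈-++⁻ ms b∈T
  ... | inj₂ (here refl) = ⊥-elim (a≁b (inj₂ (sym G close)))
  ... | inj₁ b∈ms with ∈-∃++ b∈ms
  ... | A , B , refl = record
    { left      = A
    ; right     = reverse (B ++ [ z ])
    ; leftPath  = induced-upto (a ∷ A) front
    ; rightPath = subst Induced (reverse-arc b (B ++ [ z ]) a) (induced-reverse path)
    ; cross     = All.map reverse⁺ (induced-cross A back′)
    ; leftOn    = All.++⁻ˡ A on
    ; rightOn   = reverse⁺ (All.tail (All.++⁻ʳ A on))
    }
    where
    assoc : (A ++ b ∷ B) ++ [ z ] ≡ A ++ b ∷ B ++ [ z ]
    assoc = ++-assoc A (b ∷ B) [ z ]
    back′ : Induced (A ++ b ∷ B ++ [ z ])
    back′ = subst Induced assoc back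
    on : All (λ x → OnHole x H) (A ++ b ∷ B ++ [ z ])
    on = subst (All _) assoc ∈⇒on
    path : Induced (b ∷ (B ++ [ z ]) ++ [ a ])
    path = subst (Induced ∘ (b ∷_)) (≡-sym (++-assoc B [ z ] [ a ]))
      (induced-join (b ∷ B) (induced-drop A back′) ((close ∷ []) ∷ [] ∷ [])
        (All.map (λ a≁x → far-sym a≁x ∷ []) (far-after A a≁b (induced-head front))))

  holeEdge : ∀ {x y} (H : Hole (Adj G)) → OnHole x H → OnHole y H → Adj G x y → HoleEdge H x y
  holeEdge H (i , refl) (j , refl) a = i , j , IsHole.E⇒consec (isHole H) i j a , refl , refl

  -- Holes have no chords, so vertices of a hole that are adjacent in `G` span an edge of it. For
  -- `NC` it is enough to share three vertices.
  nc-shared : ∀ {u} → NC G u → (H K : Hole (Adj G)) → OnHole u H → ¬ OnHole u K →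
    ∀ {a b c} → a ≢ c → Adj G a b → Adj G b c →
    All (λ x → OnHole x H) (a ∷ b ∷ c ∷ []) → All (λ x → OnHole x K) (a ∷ b ∷ c ∷ []) → ⊥
  nc-shared nc H K u∈H u∉K a≢c ab bc (aH ∷ bH ∷ cH ∷ []) (aK ∷ bK ∷ cK ∷ []) =
    nc H K u∈H u∉K _ _ _ a≢c
      (holeEdge H aH bH ab) (holeEdge H bH cH bc) (holeEdge K aK bK ab) (holeEdge K bK cK bc)

  -- Components and attachment to them.

  data Reach (P : Fin n → Set) (r : Fin n) : Fin n → Set where
    -- `P r` is not demanded, so the empty predicate yields the singleton of `r`.
    root : Reach P r r
    step : ∀ {x y} → Reach P r x → Adj G x y → P y → Reach P r y

  reach-all : ∀ {P r} → P r → ∀ {x} → Reach P r x → P x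
  reach-all p root         = p
  reach-all p (step _ _ q) = q

  Attached : (Fin n → Set) → Fin n → Fin n → Set
  Attached P r s = ∃ λ d → Reach P r d × Adj G d s

  -- The path is absorbed backwards from `w`; only its interior has to satisfy `P`.
  reach-back : ∀ {P r w} x xs → Induced (x ∷ xs ++ [ w ]) → All P xs → Reach P r w → Attached P r x
  reach-back x []       ((a ∷ _) ∷ _) _        ρ = _ , ρ , sym G a
  reach-back x (y ∷ ys) ((a ∷ _) ∷ p) (q ∷ qs) ρ with reach-back y ys p qs ρ
  ... | d , δ , d~y = y , step δ d~y q , sym G a

  -- If the next vertex were reached, its predecessor would be attached. If it were attached, it
  -- would be reached, since it satisfies `P`.
  unreached : ∀ {P r a u} xs → Induced (a ∷ xs ++ [ u ]) → All P xs → ¬ Reach P r a → ¬ Attached P r a →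
    All (λ x → ∀ {d} → Reach P r d → Far d x) (a ∷ xs)
  unreached {P} {r} {a} xs p qs ¬ρ ¬α = far ∷ tail xs p qs
    where
    far : ∀ {d} → Reach P r d → Far d a
    far δ (inj₁ refl) = ¬ρ δ
    far δ (inj₂ d~a)  = ¬α (_ , δ , d~a)
    tail : ∀ {u} xs → Induced (a ∷ xs ++ [ u ]) → All P xs →
      All (λ x → ∀ {d} → Reach P r d → Far d x) xs
    tail []       p             []       = []
    tail (y ∷ ys) ((a~y ∷ f) ∷ p) (q ∷ qs) =
      unreached ys p qs (λ ρ → ¬α (y , ρ , sym G a~y)) (λ (d , δ , d~y) → ¬α (y , step δ d~y q , sym G a~y))

-- Shortcuts and closing paths up to holes.

module Decided {n : ℕ} (G : Graph n) (_~?_ : Decidable (Adj G)) where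
  open InducedPaths G

  near? : Decidable Near
  near? x y = (x ≟ y) ⊎-dec (x ~? y)

  -- Enter the path at its last vertex near `x`; decidability is what finds this vertex.
  shortcut : ∀ {Q : Fin n → Set} {x t} ds → x ≢ t → All Q ds → Induced (ds ++ [ t ]) →
    Any (Near x) (ds ++ [ t ]) → ∃ λ es → All Q es × Induced (x ∷ es ++ [ t ])
  shortcut []       x≢t qs p (here (inj₁ x≡t)) = ⊥-elim (x≢t x≡t)
  shortcut []       x≢t qs p (here (inj₂ x~t)) = [] , [] , (x~t ∷ []) ∷ p
  shortcut {x = x} {t} (d ∷ ds) x≢t (q ∷ qs) (t′ ∷ p) near with Any.any? (near? x) (ds ++ [ t ])
  ... | yes later = shortcut ds x≢t qs p later
  ... | no none with near
  ...   | there later      = ⊥-elim (none later)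
  ...   | here (inj₁ refl) = ds , qs , t′ ∷ p
  ...   | here (inj₂ x~d)  = d ∷ ds , q ∷ qs , (x~d ∷ All.¬Any⇒All¬ _ none) ∷ t′ ∷ p

  module _ {P : Fin n → Set} {r : Fin n} where

    Link : Fin n → Fin n → Set
    Link t x = ∃ λ ds → All (Reach P r) ds × Induced (x ∷ ds ++ [ t ])

    extend : ∀ {t x y} → Reach P r x → y ≢ t → Adj G y x → Link t x → Link t y
    extend ρ y≢t y~x (ds , δs , p) = shortcut (_ ∷ ds) y≢t (ρ ∷ δs) p (here (inj₂ y~x))

    module _ {t : Fin n} (t∉ : ¬ Reach P r t) where

      reach-≢ : ∀ {x} → Reach P r x → x ≢ t
      reach-≢ ρ refl = t∉ ρ

      -- The link is carried back along the walk from the root, one vertex at a time, with a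
      -- shortcut after each.
      toRoot : ∀ {x} → Reach P r x → Link t x → Link t r
      toRoot root           l = l
      toRoot ρ′@(step ρ a _) l = toRoot ρ (extend ρ′ (reach-≢ ρ) a l)

      fromRoot : ∀ {x} → Reach P r x → Link t r → Link t x
      fromRoot root             l = l
      fromRoot ρ′@(step ρ a _) l = extend ρ (reach-≢ ρ′) (sym G a) (fromRoot ρ l)

      -- Start with the edge into `t`, go to the root, then out to the neighbour of `s`.
      link : ∀ {s} → s ≢ t → Attached P r s → Attached P r t → Link t s
      link s≢t (d , δ , d~s) (e , ε , e~t) =
        extend δ s≢t (sym G d~s)
          (fromRoot δ (toRoot ε ([] , [] , (e~t ∷ []) ∷ [] ∷ [])))

    -- An induced link from `t` to `s` inside the connected set completes the path to a cycle.
    -- Chords between link and path are excluded because `A` is far from the set.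
    closeUp : ∀ {s t} A → Induced (s ∷ A ++ [ t ]) → Far s t →
      All (λ a → ∀ {d} → Reach P r d → Far d a) A → ¬ Reach P r s → ¬ Reach P r t →
      Attached P r s → Attached P r t →
      ∃ λ (H : Hole (Adj G)) → All (λ x → OnHole x H) (s ∷ A ++ [ t ]) ×
        (∀ {x} → OnHole x H → x ∈ s ∷ A ++ [ t ] ⊎ Reach P r x)
    closeUp [] ((s~t ∷ _) ∷ _) s≁t = ⊥-elim (s≁t (inj₂ s~t))
    closeUp {s} {t} (a ∷ A) p s≁t far s∉ t∉ αs αt with link s∉ (s≁t ∘ inj₁ ∘ ≡-sym) αt αs
    ... | [] , _ , ((t~s ∷ _) ∷ _) = ⊥-elim (s≁t (inj₂ (sym G t~s)))
    ... | d ∷ ds , δ ∷ δs , ((t~d ∷ t≁) ∷ q) = H , All.tabulate on , off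
      where
      far-of : ∀ {x} → Reach P r x → All (Far x) (a ∷ A)
      far-of ρ = All.map (λ f → f ρ) far
      cyc : Cyclic d (ds ++ s ∷ a ∷ A ++ [ t ])
      cyc = record
        { mids  = ds ++ s ∷ a ∷ A
        ; end   = t
        ; split = ≡-sym (++-assoc ds (s ∷ a ∷ A) [ t ])
        ; front = induced-join (d ∷ ds) q (induced-take (s ∷ a ∷ A) p) (All.map far-of (δ ∷ δs))
        ; back  = induced-join ds (induced-drop [ d ] q) p
            (All.zipWith (λ (ρ , t≁x) → All.++⁺ (far-of ρ) (far-sym t≁x ∷ [])) (δs , All.++⁻ˡ ds t≁))
        ; close = t~d
        ; big   = ≤-trans (s≤s (s≤s (≤-trans (s≤s z≤n) (length-++-≤ʳ [ t ] {A})))) (length-++-≤ʳ _ {ds})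
        }
      H : Hole (Adj G)
      H = cyclic⇒hole cyc
      on : ∀ {x} → x ∈ s ∷ a ∷ A ++ [ t ] → OnHole x H
      on x∈ = Any.index x∈L , ≡-sym (Any.lookup-index x∈L)
        where x∈L = there {x = d} (∈-++⁺ʳ ds x∈)
      off : ∀ {x} → OnHole x H → x ∈ s ∷ a ∷ A ++ [ t ] ⊎ Reach P r x
      off (i , refl) with ∈-++⁻ (d ∷ ds) (∈-lookup {xs = d ∷ ds ++ s ∷ a ∷ A ++ [ t ]} i)
      ... | inj₁ x∈ds = inj₂ (All.lookup (δ ∷ δs) x∈ds)
      ... | inj₂ x∈p  = inj₁ x∈p

  -- Consequences of NC for a vertex v far from u.

  module _ {u : Fin n} (nc : NC G u) {v : Fin n} (v≁u : Far v u) where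

    Outside : Fin n → Set
    Outside y = Far v y × y ≢ u

    -- Marks the first neighbour of `v` on `xs`.
    record Blocked (xs : List (Fin n)) : Set where
      field
        {before after} : List (Fin n)
        {stop}         : Fin n
        split : xs ≡ (before ++ [ stop ]) ++ after
        v~    : Adj G v stop
        v≁    : All (Far v) before

    -- Until a neighbour of `v` appears, the walk towards `u` stays in the component of `w`.
    escape : ∀ {w y} → Outside w → Reach Outside w y → ∀ xs → Induced (y ∷ xs ++ [ u ]) →
      Attached Outside w u ⊎ Blocked xs
    escape out ρ [] ((a ∷ _) ∷ _) = inj₁ (_ , ρ , a)
    escape out ρ (x ∷ xs) ((a ∷ _) ∷ p) with near? v x
    -- The path cannot meet `v` itself first, since the preceding vertex `y` is far from `v`.
    ... | yes (inj₁ refl) = ⊥-elim (proj₁ (reach-all out ρ) (inj₂ (sym G a)))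
    ... | yes (inj₂ v~x)  = inj₂ (record { before = [] ; split = refl ; v~ = v~x ; v≁ = [] })
    ... | no v≁x with escape out (step ρ a (v≁x , All.head (induced-end (x ∷ xs) p))) xs p
    ...   | inj₁ α = inj₁ α
    ...   | inj₂ record { split = refl ; v~ = v~ ; v≁ = v≁ } =
      inj₂ (record { before = x ∷ _ ; split = refl ; v~ = v~ ; v≁ = v≁x ∷ v≁ })

    -- The stretch from `r` through `w` to `t` has interior far from `v`, so `v` closes it up to a
    -- hole that avoids `u` and shares with `H` both edges at `w`.
    ¬both-blocked : ∀ {w} (H : Hole (Adj G)) → OnHole u H → OnHole w H → Outside w →
      (A : Arcs H w u) → Blocked (Arcs.left A) → Blocked (Arcs.right A) → ⊥
    ¬both-blocked {w} H u∈H w∈H (v≁w , w≢u)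
      record { leftPath = p ; rightPath = q ; cross = cross ; leftOn = onˡ ; rightOn = onʳ }
      record { before = A ; after = A′ ; stop = r ; split = refl ; v~ = v~r ; v≁ = v≁A }
      record { before = B ; after = B′ ; stop = t ; split = refl ; v~ = v~t ; v≁ = v≁B } =
      let (a , a∈A , w~a) = induced-next A p′
          (b , b∈B , w~b) = induced-next B q′
          (onA , onwB) = ʳ++⁻ (A ++ [ r ]) (subst (All _) (≡-sym arc-eq) (proj₁ (proj₂ closed)))
      in nc-shared nc H (proj₁ closed) u∈H u∉K
        (λ a≡b → All.lookup (All.lookup cross′ a∈A) b∈B (inj₁ a≡b)) (sym G w~a) w~b
        (All.lookup (All.++⁻ˡ (A ++ [ r ]) onˡ) a∈A ∷ w∈H ∷ All.lookup (All.++⁻ˡ (B ++ [ t ]) onʳ) b∈B ∷ [])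
        (All.lookup onA a∈A ∷ All.head onwB ∷ All.lookup (All.tail onwB) b∈B ∷ [])
      where
      p′ : Induced (w ∷ A ++ [ r ])
      p′ = induced-take (w ∷ A ++ [ r ]) (induced-take (w ∷ (A ++ [ r ]) ++ A′) p)
      q′ : Induced (w ∷ B ++ [ t ])
      q′ = induced-take (w ∷ B ++ [ t ]) (induced-take (w ∷ (B ++ [ t ]) ++ B′) q)
      cross′ : AllFar (A ++ [ r ]) (B ++ [ t ])
      cross′ = All.map (All.++⁻ˡ (B ++ [ t ])) (All.++⁻ˡ (A ++ [ r ]) cross)
      r≁t : Far r t
      r≁t = All.head (All.++⁻ʳ B (All.head (All.++⁻ʳ A cross′)))
      path : Induced ((A ++ [ r ]) ʳ++ w ∷ B ++ [ t ])
      path = induced-ʳ++ (A ++ [ r ]) p′ q′ cross′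
      arc-eq : (A ++ [ r ]) ʳ++ w ∷ B ++ [ t ] ≡ r ∷ (A ʳ++ w ∷ B) ++ [ t ]
      arc-eq = trans (++-ʳ++ A) (cong (r ∷_) (≡-sym (ʳ++-assoc A)))
      -- The connected set for `closeUp` is here the singleton of `v`.
      only : ∀ {x} → Far v x → ∀ {d} → Reach (λ _ → ⊥) v d → Far d x
      only v≁x root = v≁x
      closed : ∃ λ (K : Hole (Adj G)) → All (λ x → OnHole x K) (r ∷ (A ʳ++ w ∷ B) ++ [ t ]) ×
        (∀ {x} → OnHole x K → x ∈ r ∷ (A ʳ++ w ∷ B) ++ [ t ] ⊎ Reach (λ _ → ⊥) v x)
      closed = closeUp (A ʳ++ w ∷ B) (subst Induced arc-eq path) r≁t
        (ʳ++⁺ (All.map only v≁A) (only v≁w ∷ All.map only v≁B))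
        (λ { root → irref G v~r }) (λ { root → irref G v~t })
        (v , root , v~r) (v , root , v~t)
      path≢u : All (_≢ u) (r ∷ (A ʳ++ w ∷ B) ++ [ t ])
      path≢u = subst (All _) arc-eq
        (ʳ++⁺ (All.++⁻ˡ (A ++ [ r ]) (All.tail (induced-end (w ∷ (A ++ [ r ]) ++ A′) p)))
          (w≢u ∷ All.++⁻ˡ (B ++ [ t ]) (All.tail (induced-end (w ∷ (B ++ [ t ]) ++ B′) q))))
      u∉K : ¬ OnHole u (proj₁ closed)
      u∉K u∈K with proj₂ (proj₂ closed) u∈K
      ... | inj₁ u∈path = All.lookup path≢u u∈path refl
      ... | inj₂ root   = v≁u (inj₁ refl)

    -- An old edge attaches `u` directly. A new edge brings a hole through `u` and `w`, one of whose
    -- arcs is not blocked.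
    u-attached : ∀ {w} → Outside w → StarAdj G u u w → Attached Outside w u
    u-attached out (inj₁ u~w) = _ , root , sym G u~w
    u-attached out@(_ , w≢u) (inj₂ (inj₂ (w≡u , _))) = ⊥-elim (w≢u w≡u)
    u-attached {w} out (inj₂ (inj₁ (_ , H , u∈H , w∈H , w≢u , u≁w))) =
      let arcs = holeArcs H w∈H u∈H [ w≢u , u≁w ∘ sym G ]′ in
      [ id , (λ bˡ → [ id , (λ bʳ → ⊥-elim (¬both-blocked H u∈H w∈H out arcs bˡ bʳ)) ]′
                       (escape out root _ (Arcs.rightPath arcs))) ]′
        (escape out root _ (Arcs.leftPath arcs))

    -- The component would close `a`, `v`, `b` up to a hole without `u` that shares with `H` both
    -- edges at `v`.
    ¬both-attached : ∀ {w a b A B} (H : Hole (Adj G)) → OnHole u H → Outside w →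
      All (λ x → OnHole x H) (a ∷ v ∷ b ∷ []) → Far a b →
      Induced (v ∷ (a ∷ A) ++ [ u ]) → Induced (v ∷ (b ∷ B) ++ [ u ]) →
      Attached Outside w a → Attached Outside w b → ⊥
    ¬both-attached {w} {a} {b} {A} {B} H u∈H out on a≁b p@((v~a ∷ _) ∷ _) q@((v~b ∷ _) ∷ _) αa αb
      with closeUp (v ∷ []) ((sym G v~a ∷ a≁b ∷ []) ∷ (v~b ∷ []) ∷ [] ∷ []) a≁b
             ((λ δ → far-sym (proj₁ (reach-all out δ))) ∷ [])
             (λ ρ → proj₁ (reach-all out ρ) (inj₂ v~a)) (λ ρ → proj₁ (reach-all out ρ) (inj₂ v~b)) αa αb
    ... | K , onK , off = nc-shared nc H K u∈H u∉K (a≁b ∘ inj₁) (sym G v~a) v~b on onK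
      where
      u∉K : ¬ OnHole u K
      u∉K u∈K with off u∈K | induced-end (v ∷ a ∷ A) p | induced-end (v ∷ b ∷ B) q
      ... | inj₁ (here refl)                 | _ ∷ a≢u ∷ _ | _           = a≢u refl
      ... | inj₁ (there (here refl))         | v≢u ∷ _     | _           = v≢u refl
      ... | inj₁ (there (there (here refl))) | _           | _ ∷ b≢u ∷ _ = b≢u refl
      ... | inj₂ ρ                           | _           | _           = proj₂ (reach-all out ρ) refl

    -- As `a` is not attached, the arc stays far from the component until `u`; so does its shortcut
    -- from `x`, which the component then closes up.
    holeThroughArc : ∀ {w x a A} → Outside w → StarAdj G u u w → x ≢ u → ¬ Adj G u x →
      Adj G v x → Attached Outside w x →
      Induced (v ∷ (a ∷ A) ++ [ u ]) → ¬ Attached Outside w a →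
      ∃ λ (H : Hole (Adj G)) → OnHole u H × OnHole x H
    holeThroughArc {w} {x} {a} {A} out u~w x≢u u≁x v~x αx p@((v~a ∷ v≁) ∷ q) ¬αa
      with shortcut {Q = λ y → ∀ {d} → Reach Outside w d → Far d y} (v ∷ a ∷ A) x≢u
             ((λ δ → far-sym (proj₁ (reach-all out δ))) ∷
              unreached A q
                (All.zip (All.++⁻ˡ A v≁ , All.tail (induced-end (a ∷ A) q)))
                (λ ρ → proj₁ (reach-all out ρ) (inj₂ v~a)) ¬αa)
             p (here (inj₂ (sym G v~x)))
    ... | es , far , path
      with closeUp es path [ x≢u , u≁x ∘ sym G ]′ far
             (λ ρ → proj₁ (reach-all out ρ) (inj₂ v~x)) (λ ρ → proj₂ (reach-all out ρ) refl)
             αx (u-attached out u~w)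
    ... | K , on ∷ ons , _ = K , All.head (All.++⁻ʳ es ons) , on

    no-star-path : ∀ {x w} ms (H : Hole (Adj G)) → OnHole u H → OnHole v H →
      Induced (v ∷ x ∷ ms ++ [ w ]) → All (_≢ u) (x ∷ ms ++ [ w ]) →
      ¬ StarAdj G u u x → StarAdj G u u w → ⊥
    no-star-path {x} {w} ms H u∈H v∈H ((v~x ∷ v≁) ∷ p) (x≢u ∷ ≢u) u≁x u~w
      with holeArcs H v∈H u∈H v≁u
    ... | record { left = [] ; leftPath = (v~u ∷ _) ∷ _ } = v≁u (inj₂ v~u)
    ... | record { right = [] ; rightPath = (v~u ∷ _) ∷ _ } = v≁u (inj₂ v~u)
    ... | record { left = a ∷ A ; right = b ∷ B ; leftPath = pa ; rightPath = pb
                 ; cross = (a≁b ∷ _) ∷ _ ; leftOn = a∈H ∷ _ ; rightOn = b∈H ∷ _ } =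
      -- Attachment is known only up to double negation, which is enough for the goal `⊥`.
      attached pa λ αa → attached pb λ αb →
        ¬both-attached H u∈H out (a∈H ∷ v∈H ∷ b∈H ∷ []) a≁b pa pb αa αb
      where
      outs : All Outside (ms ++ [ w ])
      outs = All.zip (v≁ , ≢u)
      out : Outside w
      out = All.head (All.++⁻ʳ ms outs)
      attached : ∀ {a A} → Induced (v ∷ (a ∷ A) ++ [ u ]) → ¬ ¬ Attached Outside w a
      attached pa ¬αa
        with holeThroughArc out u~w x≢u (u≁x ∘ inj₁) v~x (reach-back x ms p (All.++⁻ˡ ms outs) root) pa ¬αa
      ... | K , u∈K , x∈K = u≁x (inj₂ (inj₁ (refl , K , u∈K , x∈K , x≢u , u≁x ∘ inj₁)))

-- Double negation commutes with quantification over a finite set.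
¬¬-decidable : ∀ {n} (R : Fin n → Fin n → Set) → ¬ ¬ (Decidable R)
¬¬-decidable R = sequence applicative λ x → sequence applicative λ y → ¬¬-excluded-middle
  where applicative = RawMonad.rawApplicative ¬¬-Monad

-- The graph G* and its holes.

star : ∀ {n} → Graph n → Fin n → Graph n
star G u = record { Adj = StarAdj G u ; sym = star-sym ; irref = star-irref }
  where
  star-sym : ∀ {x y} → StarAdj G u x y → StarAdj G u y x
  star-sym (inj₁ a)        = inj₁ (sym G a)
  star-sym (inj₂ (inj₁ e)) = inj₂ (inj₂ e)
  star-sym (inj₂ (inj₂ e)) = inj₂ (inj₁ e)
  star-irref : ∀ {x} → ¬ StarAdj G u x x
  star-irref (inj₁ a)                                        = irref G a
  star-irref (inj₂ (inj₁ (x≡u , _ , _ , _ , x≢u , _))) = x≢u x≡u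
  star-irref (inj₂ (inj₂ (x≡u , _ , _ , _ , x≢u , _))) = x≢u x≡u

module _ {n : ℕ} (G : Graph n) (u : Fin n) where
  open InducedPaths G
  module Star = InducedPaths (star G u)

  unstar : ∀ {x y} → x ≢ u → y ≢ u → StarAdj G u x y → Adj G x y
  unstar x≢u y≢u (inj₁ a)                = a
  unstar x≢u y≢u (inj₂ (inj₁ (x≡u , _))) = ⊥-elim (x≢u x≡u)
  unstar x≢u y≢u (inj₂ (inj₂ (y≡u , _))) = ⊥-elim (y≢u y≡u)

  unstar-far : ∀ {x y} → Star.Far x y → Far x y
  unstar-far f (inj₁ x≡y) = f (inj₁ x≡y)
  unstar-far f (inj₂ x~y) = f (inj₂ (inj₁ x~y))

  unstar-induced : ∀ {xs} → All (_≢ u) xs → Star.Induced xs → Induced xs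
  unstar-induced []               Star.[]                            = []
  unstar-induced (x≢u ∷ [])       (Star.[] Star.∷ Star.[])           = [] ∷ []
  unstar-induced (x≢u ∷ y≢u ∷ qs) ((a Star.∷ f) Star.∷ p) =
    (unstar x≢u y≢u a ∷ All.map unstar-far f) ∷ unstar-induced (y≢u ∷ qs) p

  module _ (nc : NC G u) where

    -- The path is a hole of G* through `u` with `u` removed. It avoids `u`, so all its edges are
    -- edges of `G`.
    no-new-end : ∀ {v w} N → Star.Induced (v ∷ N ++ [ w ]) → Star.Far v w → All (Star.Far u) N →
      StarAdj G u u w → ¬ NewEdge G u v
    no-new-end []      ((v~w Star.∷ _) Star.∷ _) v≁w _ _ _ = v≁w (inj₂ v~w)
    no-new-end (x ∷ N) p v≁w (u≁x ∷ u≁N) u~w (H , u∈H , v∈H , v≢u , u≁v) =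
      ¬¬-decidable (Adj G) λ _~?_ →
        Decided.no-star-path G _~?_ nc [ v≢u , u≁v ∘ sym G ]′ N H u∈H v∈H
          (unstar-induced (v≢u ∷ rest≢u) p) rest≢u (u≁x ∘ inj₂) u~w
      where
      rest≢u : All (_≢ u) (x ∷ N ++ [ _ ])
      rest≢u = All.++⁺ {xs = x ∷ N} (All.map (λ f e → f (inj₁ (≡-sym e))) (u≁x ∷ u≁N))
        ((λ { refl → irref (star G u) u~w }) ∷ [])

    -- A new edge at `u` would be an edge of the hole, so `v` is one of the two neighbours of `u` on
    -- it; reversal reduces the last one to the first.
    star-hole-old-edges : (H : Hole (StarAdj G u)) → ∀ {v} → OnHole u H → OnHole v H → ¬ NewEdge G u v
    star-hole-old-edges H {v} u∈H v∈H new@(_ , _ , _ , v≢u , _) with Star.hole⇒cyclic H u∈H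
    ... | T , cyc , on⇒∈ , _ with on⇒∈ v∈H
    ... | here v≡u = v≢u v≡u
    ... | there v∈T with cyc
    ... | record { mids = [] ; split = refl ; big = s≤s () }
    ... | record { mids = _ ∷ [] ; split = refl ; big = s≤s (s≤s ()) }
    ... | record { mids = y ∷ x ∷ N ; end = z ; split = refl ; front = (u~y Star.∷ u≁N) Star.∷ _
                 ; back = p@((_ Star.∷ y≁) Star.∷ _) ; close = z~u } = ends v∈T
      where
      y≁z : Star.Far y z
      y≁z = All.head (All.++⁻ʳ N y≁)
      ends : v ∈ y ∷ (x ∷ N) ++ [ z ] → ⊥
      ends (here refl) = no-new-end (x ∷ N) p y≁z u≁N (sym (star G u) z~u) new
      ends (there v∈) with ∈-++⁻ (x ∷ N) v∈
      ... | inj₁ v∈N         = All.lookup u≁N v∈N (inj₂ (inj₂ (inj₁ (refl , new))))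
      ... | inj₂ (here refl) = no-new-end (reverse (x ∷ N))
        (subst Star.Induced (Star.reverse-arc y (x ∷ N) z) (Star.induced-reverse p))
        (Star.far-sym y≁z) (Star.reverse⁺ u≁N) u~y new

theorem2p6 : {n : ℕ} (G : Graph n) (u : Fin n) → NC G u →
    (k : ℕ) (c : Fin k → Fin n) → IsHole (StarAdj G u) k c → IsHole (Adj G) k c
theorem2p6 G u nc k c hole = record
  { len≥4    = len≥4
  ; distinct = distinct
  ; consec⇒E = λ i j s → old i j (consec⇒E i j s)
  ; E⇒consec = λ i j a → E⇒consec i j (inj₁ a)
  }
  where
  open IsHole hole
  H : Hole (StarAdj G u)
  H = record { len = k ; vtx = c ; isHole = hole }
  -- A new edge has `u` as an end, so `u` lies on the hole.
  old : ∀ i j → StarAdj G u (c i) (c j) → Adj G (c i) (c j)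
  old i j (inj₁ a)                  = a
  old i j (inj₂ (inj₁ (ci≡u , new))) = ⊥-elim (star-hole-old-edges G u nc H (i , ci≡u) (j , refl) new)
  old i j (inj₂ (inj₂ (cj≡u , new))) = ⊥-elim (star-hole-old-edges G u nc H (j , cj≡u) (i , refl) new)
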